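{- Let $\mathcal{G}$ be an $(n,d)$-small parity game and let $\mathcal{T}^{\mathrm{Even}}=\langle\mathcal{T}^{\mathrm{Even}}_1,\dots,\mathcal{T}^{\mathrm{Even}}_\ell\rangle$ and $\mathcal{T}^{\mathrm{Odd}}=\langle\mathcal{T}^{\mathrm{Odd}}_1,\dots,\mathcal{T}^{\mathrm{Odd}}_k\rangle$ be ordered trees of height at most $\lceil d/2\rceil$ and $\lfloor d/2\rfloor$, respectively. (a) If $d$ is even and $\mathcal{G}_1,\dots,\mathcal{G}_{k+1}$ are the games computed in the successive iterations of the loop in the call $\mathrm{Univ}_{\mathrm{Even}}(\mathcal{G},d,\mathcal{T}^{\mathrm{Even}},\mathcal{T}^{\mathrm{Odd}})$, then for every $i=0,1,\dots,k$, the game $\mathcal{G}_{i+1}$ separates every Even dominion in $\mathcal{G}$ that the tree $\mathcal{T}^{\mathrm{Even}}$ embeds from every Odd dominion in $\mathcal{G}$ that the tree $\langle\mathcal{T}^{\mathrm{Odd}}_1,\dots,\mathcal{T}^{\mathrm{Odd}}_i\rangle$ embeds. (b) If $d$ is odd and $\mathcal{G}_1,\dots,\mathcal{G}_{\ell+1}$ are the games computed in the successive iterations of the loop in the call $\mathrm{Univ}_{\mathrm{Odd}}(\mathcal{G},d,\mathcal{T}^{\mathrm{Even}},\mathcal{T}^{\mathrm{Odd}})$, then for every $i=0,1,\dots,\ell$, the game $\mathcal{G}_{i+1}$ separates every Odd dominion in $\mathcal{G}$ that the tree $\mathcal{T}^{\mathrm{Odd}}$ embeds from every Even dominion in $\mathcal{G}$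 that the tree $\langle\mathcal{T}^{\mathrm{Even}}_1,\dots,\mathcal{T}^{\mathrm{Even}}_i\rangle$ embeds.
   Context: **Separation.** A set $X$ separates $A$ from $B$ if $A\subseteq X$ and $X\cap B=\emptyset$ (a game is identified with its vertex set). **Parity games.** A parity game $\mathcal{G}$ consists of a finite directed graph $(V,E)$ in which every vertex has at least one outgoing edge, a partition $(V_{\mathrm{Even}},V_{\mathrm{Odd}})$ of $V$, and a function $\pi$ assigning to each vertex a non-negative integer, its priority. It is $(n,d)$-small if it has at most $n$ vertices and all priorities are at most $d$. For $S\subseteq V$, $\mathcal{G}\cap S$ is the substructure induced by $S$, and $\mathcal{G}\setminus S=\mathcal{G}\cap(V\setminus S)$. It is called a subgame if every vertex of it has an outgoing edge inside it. $V^{\mathcal{G}'}$ denotes the vertex set of $\mathcal{G}'$. The empty game is allowed as a subgame. **Strategies, traps, dominia.** A cycle is even if the highest priority on it is even, and odd otherwise. An Even strategy is a set $\sigma\subseteq E$ such that every $v\in V_{\mathrm{Even}}$ has an outgoing edge in $\sigma$ and every outgoing edge of every $v\in V_{\mathrm{Odd}}$ is in $\sigma$. A set $T$ is a trap for Odd if there is an Even strategy $\sigma$ such that $w\in T$ and $(w,u)\in\sigma$ imply $u\in T$ (then $\sigma$ traps Odd in $T$). A set $D$ is an Even dominion if there is an Even strategy $\sigma$ that traps Odd in $D$ and such that every cycle in the subgraph $(D,\sigma)$ is even. Odd strategies, traps for Even, and Odd dominia are defined by swapping the players (and requiring odd cycles). The empty set counts as a trap and as a dominion. **Attractors.** For $B\subseteq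 A\subseteq V$, an Even strategy $\sigma$ is an Even reachability strategy to $B$ from $A$ if every infinite path in $(V,\sigma)$ starting in $A$ contains a vertex of $B$. $\mathrm{Attr}_{\mathrm{Even}}^{\mathcal{G}}(B)$, the Even attractor to $B$ in $\mathcal{G}$, is the largest set from which there is an Even reachability strategy to $B$. $\mathrm{Attr}_{\mathrm{Odd}}^{\mathcal{G}}(B)$ is defined analogously. **Ordered trees.** An ordered tree is the trivial tree $\langle\rangle$ (of height $0$) or a finite sequence $\langle\mathcal{T}_1,\dots,\mathcal{T}_k\rangle$ of ordered trees. Every ordered tree embeds $\langle\rangle$, and $\langle\mathcal{T}_1,\dots,\mathcal{T}_k\rangle$ embeds $\langle\mathcal{T}'_1,\dots,\mathcal{T}'_\ell\rangle$ if there are $1\le i_1<\dots<i_\ell\le k$ such that $\mathcal{T}_{i_j}$ embeds $\mathcal{T}'_j$ for all $j=1,\dots,\ell$. **Attractor decompositions.** Let $e\geq 0$ be even and let $\mathcal{G}$ have all priorities at most $e$. An Even $e$-attractor decomposition of $\mathcal{G}$ is $\mathcal{H}=\langle A,(S_1,\mathcal{H}_1,A_1),\dots,(S_k,\mathcal{H}_k,A_k)\rangle$ such that $A$ is the Even attractor in $\mathcal{G}$ to the set of vertices of priority $e$ and, setting $\mathcal{G}_1=\mathcal{G}\setminus A$, for $i=1,\dots,k$: $S_i$ is a non-empty trap for Odd in $\mathcal{G}_i$ in which every priority is at most $e-2$; $\mathcal{H}_i$ is an Even $(e-2)$-attractor decomposition of $\mathcal{G}\cap S_i$; $A_i$ is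 the Even attractor to $S_i$ in $\mathcal{G}_i$; $\mathcal{G}_{i+1}=\mathcal{G}_i\setminus A_i$; and $\mathcal{G}_{k+1}$ is empty. If $e=0$ then $k=0$ is required. Odd $e$-attractor decompositions, for odd $e$, are defined by swapping the players. The tree of $\mathcal{H}$ is $\mathcal{T}_{\mathcal{H}}=\langle\rangle$ if $k=0$, and $\mathcal{T}_{\mathcal{H}}=\langle\mathcal{T}_{\mathcal{H}_1},\dots,\mathcal{T}_{\mathcal{H}_k}\rangle$ otherwise. **Embedding dominia.** An ordered tree embeds a dominion $D$ of $\mathcal{G}$ if it embeds the tree of some attractor decomposition of $\mathcal{G}\cap D$: for an Even dominion, an Even $e$-attractor decomposition, where $e$ is the least even number $\ge d$; for an Odd dominion, an Odd $e$-attractor decomposition, where $e$ is the least odd number $\geq d$. **Universal attractor decomposition algorithm.** Two mutually recursive procedures. $\mathrm{Univ}_{\mathrm{Even}}(\mathcal{G},d,\mathcal{T}^{\mathrm{Even}},\mathcal{T}^{\mathrm{Odd}})$: let $\mathcal{T}^{\mathrm{Odd}}=\langle\mathcal{T}^{\mathrm{Odd}}_1,\dots,\mathcal{T}^{\mathrm{Odd}}_k\rangle$ and $\mathcal{G}_1=\mathcal{G}$. For $i=1,\dots,k$: $D_i=\pi^{ -1}(d)\cap\mathcal{G}_i$; $\mathcal{G}'_i=\mathcal{G}_i\setminus\mathrm{Attr}_{\mathrm{Even}}^{\mathcal{G}_i}(D_i)$; $U_i=\mathrm{Univ}_{\mathrm{Odd}}(\mathcal{G}'_i,d-1,\mathcal{T}^{\mathrm{Even}},\mathcal{T}^{\mathrm{Odd}}_i)$;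 $\mathcal{G}_{i+1}=\mathcal{G}_i\setminus\mathrm{Attr}_{\mathrm{Odd}}^{\mathcal{G}_i}(U_i)$. Return $V^{\mathcal{G}_{k+1}}$. $\mathrm{Univ}_{\mathrm{Odd}}(\mathcal{G},d,\mathcal{T}^{\mathrm{Even}},\mathcal{T}^{\mathrm{Odd}})$: let $\mathcal{T}^{\mathrm{Even}}=\langle\mathcal{T}^{\mathrm{Even}}_1,\dots,\mathcal{T}^{\mathrm{Even}}_\ell\rangle$ and $\mathcal{G}_1=\mathcal{G}$. For $i=1,\dots,\ell$: $D_i=\pi^{ -1}(d)\cap\mathcal{G}_i$; $\mathcal{G}'_i=\mathcal{G}_i\setminus\mathrm{Attr}_{\mathrm{Odd}}^{\mathcal{G}_i}(D_i)$; $U_i=\mathrm{Univ}_{\mathrm{Even}}(\mathcal{G}'_i,d-1,\mathcal{T}^{\mathrm{Even}}_i,\mathcal{T}^{\mathrm{Odd}})$; $\mathcal{G}_{i+1}=\mathcal{G}_i\setminus\mathrm{Attr}_{\mathrm{Even}}^{\mathcal{G}_i}(U_i)$. Return $V^{\mathcal{G}_{\ell+1}}$. -}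

module Defs where

open import Data.Bool using (if_then_else_)
open import Data.Fin using (Fin; zero; suc; fromℕ; inject₁)
open import Data.Fin.Properties using (_≟_; any?; all?; ¬∀⟶∃¬)
open import Data.Fin.Subset
open import Data.Fin.Subset.Induction using (Acc; acc; ⊃-wellFounded)
open import Data.Fin.Subset.Properties
open import Data.List using (List; []; _∷_; length)
open import Data.List.Relation.Binary.Sublist.Heterogeneous using (Sublist)
open import Data.Nat using (ℕ; zero; suc; _≤_; _⊔_; _∸_; parity)
import Data.Nat.Properties as ℕ
open import Data.Parity using (Parity; 0ℙ; 1ℙ; _⁻¹)
import Data.Parity.Properties as ℙ
open import Data.Product using (∃; _×_; _,_; proj₁; proj₂)
open import Data.Sum using (_⊎_; inj₁; inj₂)
open import Data.Vec using (Vec; []; _∷_; here; there; last; tabulate)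
open import Function using (_∘_)
open import Function.Definitions using (Injective)
open import Relation.Binary.PropositionalEquality using (_≡_; refl; sym; trans; subst)
open import Relation.Nullary using (¬_; Dec; yes; no; does; contradiction)
open import Relation.Nullary.Decidable using (_×-dec_; _⊎-dec_; _→-dec_; ¬?; decidable-stable)

Separates : ∀ {n} → Subset n → Subset n → Subset n → Set
Separates X A B = A ⊆ X × Empty (X ∩ B)

data Tree : Set where
  node : List Tree → Tree

height  : Tree → ℕ
heights : List Tree → ℕ
height (node [])         = 0
height (node ts@(_ ∷ _)) = suc (heights ts)
heights []       = 0
heights (t ∷ ts) = height t ⊔ heights ts

data _Embeds_ : Tree → Tree → Set where
  embeds : ∀ {ts us} → Sublist (λ u t → t Embeds u) us ts →
           node ts Embeds node us

-- A player is identified with the parity that is good for that player.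
Player : Set
Player = Parity

pattern Even = 0ℙ
pattern Odd  = 1ℙ

opponent : Player → Player
opponent = _⁻¹

record ParityGame : Set where
  field
    size  : ℕ
    succs : Fin size → Subset size
    total : ∀ v → Nonempty (succs v)
    owner : Fin size → Player
    π     : Fin size → ℕ

Small : ParityGame → ℕ → ℕ → Set
Small G n d = size ≤ n × (∀ v → π v ≤ d)
  where open ParityGame G

-- The least number that is at least d and has the parity of P.
level : Player → ℕ → ℕ
level P d = if does (parity d ℙ.≟ P) then d else suc d

-- Below, the substructure of G induced by a set S of vertices is represented
-- by S itself, so that G is represented by ⊤.
module _ (G : ParityGame) where
  open ParityGame G

  Vertex : Set
  Vertex = Fin size

  -- A set of edges, given by the successors of each vertex.
  EdgeSet : Set
  EdgeSet = Vertex → Subset size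

  Edge : Subset size → Vertex → Vertex → Set
  Edge S v w = v ∈ S × w ∈ S × w ∈ succs v

  IsSubgame : Subset size → Set
  IsSubgame S = ∀ {v} → v ∈ S → ∃ λ w → w ∈ S × w ∈ succs v

  ofPriority : ℕ → Subset size
  ofPriority d = tabulate λ v → does (π v ℕ.≟ d)

  record Strategy (P : Player) (S : Subset size) (σ : EdgeSet) : Set where
    field
      edges : ∀ {v w} → w ∈ σ v → Edge S v w
      own   : ∀ {v} → v ∈ S → owner v ≡ P → Nonempty (σ v)
      other : ∀ {v w} → owner v ≡ opponent P → Edge S v w → w ∈ σ v

  ClosedUnder : EdgeSet → Subset size → Set
  ClosedUnder σ T = ∀ {w u} → w ∈ T → u ∈ σ w → u ∈ T

  -- T is a trap for player Q.
  IsTrap : Player → Subset size → Subset size → Set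
  IsTrap Q S T = T ⊆ S × ∃ λ σ → Strategy (opponent Q) S σ × ClosedUnder σ T

  -- A (simple) cycle in the graph (D , σ), with its first vertex repeated at
  -- the end; it has length suc k.
  record Cycle (D : Subset size) (σ : EdgeSet) : Set where
    field
      {k}    : ℕ
      vertex : Fin (suc (suc k)) → Vertex
      closed : vertex zero ≡ vertex (fromℕ (suc k))
      within : ∀ i → vertex i ∈ D
      step   : ∀ i → vertex (suc i) ∈ σ (vertex (inject₁ i))
      simple : Injective _≡_ _≡_ (vertex ∘ inject₁)

  GoodFor : ∀ {D σ} → Player → Cycle D σ → Set
  GoodFor P c = ∃ λ i → (∀ j → π (vertex j) ≤ π (vertex i)) × parity (π (vertex i)) ≡ P
    where open Cycle c

  IsDominion : Player → Subset size → Subset size → Set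
  IsDominion P S D =
    D ⊆ S × ∃ λ σ → Strategy P S σ × ClosedUnder σ D × ((c : Cycle D σ) → GoodFor P c)

  ReachableFrom : Player → (S B A : Subset size) → Set
  ReachableFrom P S B A =
    B ⊆ A × A ⊆ S × ∃ λ σ → Strategy P S σ ×
      ((f : ℕ → Vertex) → f 0 ∈ A → (∀ i → f (suc i) ∈ σ (f i)) → ∃ λ i → f i ∈ B)

  -- A is the P-attractor to B in the substructure induced by S.
  IsAttractor : Player → (S B A : Subset size) → Set
  IsAttractor P S B A =
    ReachableFrom P S B A × (∀ {A′} → ReachableFrom P S B A′ → A′ ⊆ A)

  -- Layers P e S decomposes S, the part of a game left outside the attractor
  -- to priority e. The target e + 2 of layer forces k = 0 when e is 0 or 1;
  -- for e = 1 this is no restriction, since no priority is at most e - 2.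
  mutual
    data Decomposition (P : Player) (e : ℕ) (S : Subset size) : Set where
      decomposition : ∀ {A} → IsAttractor P S (S ∩ ofPriority e) A →
                      Layers P e (S ─ A) → Decomposition P e S

    data Layers (P : Player) : ℕ → Subset size → Set where
      done  : ∀ {e S} → Empty S → Layers P e S
      layer : ∀ {e S T A} →
              Nonempty T → IsTrap (opponent P) S T → (∀ {v} → v ∈ T → π v ≤ e) →
              Decomposition P e T →
              IsAttractor P S T A →
              Layers P (suc (suc e)) (S ─ A) →
              Layers P (suc (suc e)) S

  tree  : ∀ {P e S} → Decomposition P e S → Tree
  trees : ∀ {P e S} → Layers P e S → List Tree
  tree (decomposition _ ls) = node (trees ls)
  trees (done _)             = []
  trees (layer _ _ _ H _ ls) = tree H ∷ trees ls

  -- The tree T embeds the P-dominion D, where d bounds the priorities.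
  EmbedsDominion : Player → ℕ → Tree → Subset size → Set
  EmbedsDominion P d T D = ∃ λ (H : Decomposition P (level P d) D) → T Embeds tree H

  private
    ∈─⇒∉ : ∀ {n} {x : Fin n} (p q : Subset n) → x ∈ p ─ q → x ∉ q
    ∈─⇒∉ (_ ∷ p) (inside  ∷ q) ()        here
    ∈─⇒∉ (_ ∷ p) (_       ∷ q) (there i) (there j) = ∈─⇒∉ p q i j

    side : ∀ (P Q : Player) → Q ≡ P ⊎ Q ≡ opponent P
    side Even Even = inj₁ refl
    side Even Odd  = inj₂ refl
    side Odd  Even = inj₂ refl
    side Odd  Odd  = inj₁ refl

    module Construct (P : Player) (S : Subset size) (sub : IsSubgame S)
                     (B : Subset size) (B⊆S : B ⊆ S) where

      Attracted : Subset size → Vertex → Set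
      Attracted A v = v ∈ S × v ∉ A ×
        ((owner v ≡ P × ∃ λ w → (w ∈ S × w ∈ succs v) × w ∈ A)
         ⊎ (owner v ≡ opponent P × ∀ w → w ∈ S × w ∈ succs v → w ∈ A))

      attracted? : ∀ A v → Dec (Attracted A v)
      attracted? A v = v ∈? S ×-dec ¬? (v ∈? A) ×-dec
        ((owner v ℙ.≟ P ×-dec any? λ w → (w ∈? S ×-dec w ∈? succs v) ×-dec w ∈? A)
         ⊎-dec (owner v ℙ.≟ opponent P ×-dec
                all? λ w → (w ∈? S ×-dec w ∈? succs v) →-dec w ∈? A))

      data Forced (A : Subset size) (σ : EdgeSet) (v : Vertex) : Set where
        hit  : v ∈ B → Forced A σ v
        move : v ∈ A → (∀ w → w ∈ σ v → Forced A σ w) → Forced A σ v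

      record Stage (A : Subset size) : Set where
        field
          B⊆A    : B ⊆ A
          A⊆S    : A ⊆ S
          σ      : EdgeSet
          strat  : Strategy P S σ
          forced : ∀ {v} → v ∈ A → Forced A σ v

      allEdges : EdgeSet
      allEdges v with v ∈? S
      ... | yes _ = S ∩ succs v
      ... | no  _ = ⊥

      start : Stage B
      start = record
        { B⊆A = λ i → i ; A⊆S = B⊆S ; σ = allEdges
        ; strat = record { edges = edges′ ; own = own′ ; other = λ _ → other′ }
        ; forced = hit }
        where
        edges′ : ∀ {v w} → w ∈ allEdges v → Edge S v w
        edges′ {v} i with v ∈? S
        ... | yes v∈S = v∈S , x∈p∩q⁻ S (succs v) i
        ... | no  _   = contradiction i ∉⊥
        other′ : ∀ {v w} → Edge S v w → w ∈ allEdges v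
        other′ {v} (v∈S , e) with v ∈? S
        ... | yes _   = x∈p∩q⁺ e
        ... | no  v∉S = contradiction v∈S v∉S
        own′ : ∀ {v} → v ∈ S → owner v ≡ P → Nonempty (allEdges v)
        own′ v∈S _ with w , e ← sub v∈S = w , other′ (v∈S , e)

      transfer : ∀ {A A′ σ σ′} → A ⊆ A′ → (∀ {v w} → v ∈ A → w ∈ σ′ v → w ∈ σ v) →
                 ∀ {v} → Forced A σ v → Forced A′ σ′ v
      transfer A⊆A′ agree (hit v∈B)    = hit v∈B
      transfer A⊆A′ agree (move v∈A g) =
        move (A⊆A′ v∈A) λ w i → transfer A⊆A′ agree (g w (agree v∈A i))

      extend : ∀ {A v} → Stage A → Attracted A v → Stage (A ∪ ⁅ v ⁆)
      extend {A} {v} st (v∈S , v∉A , choice) = record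
        { B⊆A = p⊆p∪q ⁅ v ⁆ ∘ B⊆A
        ; A⊆S = A′⊆S
        ; σ = proj₁ (new choice)
        ; strat = proj₁ (proj₂ (new choice))
        ; forced = forced′ }
        where
        open Stage st
        open Strategy strat
        A′⊆S : A ∪ ⁅ v ⁆ ⊆ S
        A′⊆S i with x∈p∪q⁻ A ⁅ v ⁆ i
        ... | inj₁ j = A⊆S j
        ... | inj₂ j = subst (_∈ S) (sym (x∈⁅y⁆⇒x≡y v j)) v∈S

        new : (owner v ≡ P × ∃ λ w → (w ∈ S × w ∈ succs v) × w ∈ A)
              ⊎ (owner v ≡ opponent P × ∀ w → w ∈ S × w ∈ succs v → w ∈ A) →
              ∃ λ σ′ → Strategy P S σ′ ×
                (∀ {u w} → u ∈ A → w ∈ σ′ u → w ∈ σ u) × (∀ {w} → w ∈ σ′ v → w ∈ A)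
        new (inj₂ (_ , all)) = σ , strat , (λ _ i → i) , λ i → all _ (proj₂ (edges i))
        new (inj₁ (v-own , w , e , w∈A)) = σ′ , record
            { edges = edges′ ; own = own′ ; other = other′ } , agree , into
          where
          σ′ : EdgeSet
          σ′ u with u ≟ v
          ... | yes _ = ⁅ w ⁆
          ... | no  _ = σ u
          edges′ : ∀ {u x} → x ∈ σ′ u → Edge S u x
          edges′ {u} i with u ≟ v
          ... | no  _    = edges i
          ... | yes refl with refl ← x∈⁅y⁆⇒x≡y w i = v∈S , e
          own′ : ∀ {u} → u ∈ S → owner u ≡ P → Nonempty (σ′ u)
          own′ {u} u∈S q with u ≟ v
          ... | yes _ = w , x∈⁅x⁆ w
          ... | no  _ = own u∈S q
          other′ : ∀ {u x} → owner u ≡ opponent P → Edge S u x → x ∈ σ′ u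
          other′ {u} q f with u ≟ v
          ... | yes refl = contradiction (trans (sym v-own) q) (ℙ.p≢p⁻¹ P)
          ... | no  _    = other q f
          agree : ∀ {u x} → u ∈ A → x ∈ σ′ u → x ∈ σ u
          agree {u} u∈A i with u ≟ v
          ... | yes refl = contradiction u∈A v∉A
          ... | no  _    = i
          into : ∀ {x} → x ∈ σ′ v → x ∈ A
          into i with v ≟ v
          ... | yes _ with refl ← x∈⁅y⁆⇒x≡y w i = w∈A
          ... | no ¬p = contradiction refl ¬p

        forced′ : ∀ {u} → u ∈ A ∪ ⁅ v ⁆ → Forced (A ∪ ⁅ v ⁆) (proj₁ (new choice)) u
        forced′ {u} i with _ , _ , agree , into ← new choice | x∈p∪q⁻ A ⁅ v ⁆ i
        ... | inj₁ u∈A = transfer (p⊆p∪q ⁅ v ⁆) agree (forced u∈A)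
        ... | inj₂ j with refl ← x∈⁅y⁆⇒x≡y v j =
          move i λ w k → transfer (p⊆p∪q ⁅ v ⁆) agree (forced (into k))

      saturate : ∀ A → Acc _⊃_ A → Stage A → ∃ λ A′ → Stage A′ × (∀ v → ¬ Attracted A′ v)
      saturate A (acc rs) st with any? (attracted? A)
      ... | no  none    = A , st , λ v a → none (v , a)
      ... | yes (v , a) = saturate (A ∪ ⁅ v ⁆) (rs bigger) (extend st a)
        where
        bigger : A ⊂ A ∪ ⁅ v ⁆
        bigger = p⊆p∪q ⁅ v ⁆ , v , q⊆p∪q A ⁅ v ⁆ (x∈⁅x⁆ v) , proj₁ (proj₂ a)

      reach : ∀ {A σ} (f : ℕ → Vertex) → (∀ i → f (suc i) ∈ σ (f i)) →
              Forced A σ (f 0) → ∃ λ i → f i ∈ B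
      reach f path (hit b)    = 0 , b
      reach f path (move _ g)
        with i , b ← reach (f ∘ suc) (path ∘ suc) (g (f 1) (path 0)) = suc i , b

      module Saturated {A : Subset size} (B⊆A : B ⊆ A) (A⊆S : A ⊆ S)
                       (none : ∀ v → ¬ Attracted A v) where

        avoid-own : ∀ {v w} → v ∈ S → v ∉ A → owner v ≡ P →
                    w ∈ S × w ∈ succs v → w ∉ A
        avoid-own v∈S v∉A q e w∈A = none _ (v∈S , v∉A , inj₁ (q , _ , e , w∈A))

        avoid-other : ∀ {v} → v ∈ S → v ∉ A → owner v ≡ opponent P →
                      ∃ λ w → (w ∈ S × w ∈ succs v) × w ∉ A
        avoid-other {v} v∈S v∉A q
          with any? (λ w → (w ∈? S ×-dec w ∈? succs v) ×-dec ¬? (w ∈? A))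
        ... | yes r = r
        ... | no ¬r = contradiction
          (v∈S , v∉A , inj₂ (q , λ w e → decidable-stable (w ∈? A) λ w∉A → ¬r (w , e , w∉A)))
          (none v)

        rest-subgame : IsSubgame (S ─ A)
        rest-subgame {v} i with side P (owner v)
        ... | inj₁ q with w , e ← sub (p─q⊆p S A i) =
          w , x∈p∧x∉q⇒x∈p─q (proj₁ e) (avoid-own (p─q⊆p S A i) (∈─⇒∉ S A i) q e) , proj₂ e
        ... | inj₂ q with w , e , w∉A ← avoid-other (p─q⊆p S A i) (∈─⇒∉ S A i) q =
          w , x∈p∧x∉q⇒x∈p─q (proj₁ e) w∉A , proj₂ e

        maximal : ∀ {A′} → ReachableFrom P S B A′ → A′ ⊆ A
        maximal (_ , A′⊆S , τ , strat , reaches) {v} v∈A′ = decidable-stable (v ∈? A) absurd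
          where
          open Strategy strat
          Outside : Set
          Outside = ∃ λ u → u ∈ S × u ∉ A
          next : (o : Outside) → ∃ λ (o′ : Outside) → proj₁ o′ ∈ τ (proj₁ o)
          next (u , u∈S , u∉A) with side P (owner u)
          ... | inj₁ q with w , i ← own u∈S q =
            (w , proj₁ (proj₂ (edges i)) , avoid-own u∈S u∉A q (proj₂ (edges i))) , i
          ... | inj₂ q with w , e , w∉A ← avoid-other u∈S u∉A q =
            (w , proj₁ e , w∉A) , other q (u∈S , e)
          walk : v ∉ A → ℕ → Outside
          walk v∉A zero    = v , A′⊆S v∈A′ , v∉A
          walk v∉A (suc i) = proj₁ (next (walk v∉A i))
          absurd : ¬ v ∉ A
          absurd v∉A
            with i , b ← reaches (proj₁ ∘ walk v∉A) v∈A′ (λ i → proj₂ (next (walk v∉A i))) =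
            proj₂ (proj₂ (walk v∉A i)) (B⊆A b)

      result : ∃ λ A → IsAttractor P S B A × IsSubgame (S ─ A)
      result with A , st , none ← saturate B (⊃-wellFounded B) start =
        A , ((B⊆A , A⊆S , σ , strat , λ f i path → reach f path (forced i)) , maximal)
          , rest-subgame
        where
        open Stage st
        open Saturated B⊆A A⊆S none

  abstract
    attractor : ∀ P {S B} → IsSubgame S → B ⊆ S →
                ∃ λ A → IsAttractor P S B A × IsSubgame (S ─ A)
    attractor P sub B⊆S = Construct.result P _ sub _ B⊆S

  record Subgame : Set where
    constructor subgame
    field
      V         : Subset size
      isSubgame : IsSubgame V
  open Subgame

  whole : Subgame
  whole = subgame ⊤ λ {v} _ → proj₁ (total v) , ∈⊤ , proj₂ (total v)

  -- The P-attractor in H to those vertices of B that are in H.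
  attr : (P : Player) (H : Subgame) (B : Subset size) →
         ∃ λ A → IsAttractor P (V H) (V H ∩ B) A × IsSubgame (V H ─ A)
  attr P H B = attractor P (isSubgame H) (p∩q⊆p (V H) B)

  removeAttr : Player → Subgame → Subset size → Subgame
  removeAttr P H B = subgame (V H ─ proj₁ (attr P H B)) (proj₂ (proj₂ (attr P H B)))

  -- univ P H d T T′ is the subgame on the set returned by Univ_P, where T is
  -- the tree of P and T′ is the tree of the opponent of P. The subgames
  -- at the start and after each iteration of its loop form the vector
  -- univGames P H d T ts, where T′ = node ts. The subtraction d ∸ 1 is only
  -- truncated for trees that are too high for d.
  mutual
    univ : Player → Subgame → ℕ → Tree → Tree → Subgame
    univ P H d T (node ts) = last (univGames P H d T ts)

    univGames : Player → Subgame → ℕ → Tree → (ts : List Tree) → Vec Subgame (suc (length ts))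
    univGames P H d T []       = H ∷ []
    univGames P H d T (t ∷ ts) = H ∷ univGames P (removeAttr (opponent P) H U) d T ts
      where
      H′ = removeAttr P H (ofPriority d)
      U  = V (univ (opponent P) H′ (d ∸ 1) t T)

  -- So the intersection in attr does not affect the set U.
  mutual
    univ⊆ : ∀ P H d T T′ → V (univ P H d T T′) ⊆ V H
    univ⊆ P H d T (node ts) = univGames⊆ P H d T ts

    univGames⊆ : ∀ P H d T ts → V (last (univGames P H d T ts)) ⊆ V H
    univGames⊆ P H d T []       i = i
    univGames⊆ P H d T (t ∷ ts) i = p─q⊆p (V H) _ (univGames⊆ P _ d T ts i)

{-# OPTIONS --safe #-}

-- S ─ Attr_P(B) is the largest trap for P in S disjoint from B. Hence an
-- attractor decomposition of S restricts to one of any trap X for P in S, with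
-- a tree embedded in the original one. Only the trap property and the
-- decomposition of a dominion matter, not the parity of its cycles.
--
-- In an iteration of Univ_P with opponent Q, let U be the result of the
-- recursive call on H₁ and H₂ the rest after removing Attr_Q(U). A trap D for
-- Q with a P-decomposition restricts to H₁, so by induction on d it misses U,
-- and being a trap for Q it misses Attr_Q(U). A trap D for P with a
-- Q-decomposition restricts to H₂; if its first layer is the one embedded by
-- the current subtree, that layer avoids the top priority, so it is a trap for
-- P in H₁, by induction lies in U, and disappears with its attractor.
module Submission where

open import Defs
open import Data.Fin using (Fin; zero; suc; toℕ)
open import Data.Fin.Properties using (_≟_)
open import Data.Fin.Subset using (Subset; ⊤; _∈_; _∉_; _⊆_; _∩_; _∪_; _─_; ⁅_⁆; inside; Nonempty; Empty)
  renaming (⊥ to ∅)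
open import Data.Fin.Subset.Properties
open import Data.List using (List; []; _∷_; length; take)
open import Data.List.Relation.Binary.Sublist.Heterogeneous using (Sublist; []; _∷ʳ_; _∷_)
open import Data.Nat using (ℕ; zero; suc; _≤_; z≤n; s≤s; ⌈_/2⌉; ⌊_/2⌋; parity)
import Data.Nat.Properties as ℕ
import Data.Parity.Properties as ℙ
open import Data.Product using (∃; _×_; _,_; proj₁; proj₂)
open import Data.Sum using (inj₁; inj₂)
open import Data.Vec using (_∷_; here; there; lookup)
open import Data.Vec.Properties using (lookup⇒[]=; []=⇒lookup; lookup∘tabulate)
open import Function using (_∘_)
open import Relation.Binary.PropositionalEquality using (_≡_; _≢_; refl; sym; trans; cong; subst)
open import Relation.Nullary using (yes; no; does; contradiction)
open import Relation.Nullary.Decidable using (dec-true; dec-false; decidable-stable)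

-- Set difference, players and levels.

∈─⇒∉ : ∀ {n x} {p q : Subset n} → x ∈ p ─ q → x ∉ q
∈─⇒∉ {p = _ ∷ _} {inside ∷ _} ()        here
∈─⇒∉ {p = _ ∷ _} {_ ∷ _}      (there i) (there j) = ∈─⇒∉ i j

≢⇒≡opponent : ∀ {P Q} → Q ≢ P → Q ≡ opponent P
≢⇒≡opponent {Even} {Even} Q≢P = contradiction refl Q≢P
≢⇒≡opponent {Even} {Odd}  Q≢P = refl
≢⇒≡opponent {Odd}  {Even} Q≢P = refl
≢⇒≡opponent {Odd}  {Odd}  Q≢P = contradiction refl Q≢P

level-≡ : ∀ {P d} → parity d ≡ P → level P d ≡ d
level-≡ {P} {d} eq with parity d ℙ.≟ P
... | yes _ = refl
... | no ¬p = contradiction eq ¬p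

level-opponent : ∀ {P d} → parity d ≡ P → level (opponent P) d ≡ suc d
level-opponent {P} {d} eq with parity d ℙ.≟ opponent P
... | yes p = contradiction (trans (sym eq) p) (ℙ.p≢p⁻¹ P)
... | no _  = refl

-- Tree embedding and tree heights.

infix 4 _⊒_

_⊒_ : List Tree → List Tree → Set
ts ⊒ us = Sublist (λ u t → t Embeds u) us ts

mutual
  embeds-trans : ∀ {t u v} → t Embeds u → u Embeds v → t Embeds v
  embeds-trans (embeds p) (embeds q) = embeds (⊒-trans p q)

  ⊒-trans : ∀ {ts us vs} → ts ⊒ us → us ⊒ vs → ts ⊒ vs
  ⊒-trans (t ∷ʳ p) q        = t ∷ʳ ⊒-trans p q
  ⊒-trans (e ∷ p)  (_ ∷ʳ q) = _ ∷ʳ ⊒-trans p q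
  ⊒-trans (e ∷ p)  (f ∷ q)  = embeds-trans e f ∷ ⊒-trans p q
  ⊒-trans []       []       = []

height-head : ∀ t ts {m} → height (node (t ∷ ts)) ≤ suc m → height t ≤ m
height-head t ts (s≤s h) = ℕ.m⊔n≤o⇒m≤o _ _ h

height-tail : ∀ t ts {m} → height (node (t ∷ ts)) ≤ m → height (node ts) ≤ m
height-tail t []      h       = z≤n
height-tail t (_ ∷ _) (s≤s h) = s≤s (ℕ.m⊔n≤o⇒n≤o (height t) _ h)

height-take : ∀ i ts {m} → height (node ts) ≤ m → height (node (take i ts)) ≤ m
height-take zero    ts       h       = z≤n
height-take (suc i) []       h       = z≤n
height-take (suc i) (t ∷ ts) (s≤s h) =
  s≤s (ℕ.≤-trans (ℕ.⊔-monoʳ-≤ (height t) (heights-take i ts)) h)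
  where
  heights-take : ∀ i ts → heights (take i ts) ≤ heights ts
  heights-take zero    ts       = z≤n
  heights-take (suc i) []       = z≤n
  heights-take (suc i) (t ∷ ts) = ℕ.⊔-monoʳ-≤ (height t) (heights-take i ts)

-- Priority sets and traps.

module _ (G : ParityGame) where
  open ParityGame G

  ∈ofPriority⁺ : ∀ {v d} → π v ≡ d → v ∈ ofPriority G d
  ∈ofPriority⁺ {v} {d} eq = lookup⇒[]= v _
    (trans (lookup∘tabulate _ v) (dec-true (π v ℕ.≟ d) eq))

  ∈ofPriority⁻ : ∀ {v d} → v ∈ ofPriority G d → π v ≡ d
  ∈ofPriority⁻ {v} {d} i = decidable-stable (π v ℕ.≟ d) λ πv≢d → contradiction
    (trans (sym (dec-false (π v ℕ.≟ d) πv≢d))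
           (trans (sym (lookup∘tabulate (λ u → does (π u ℕ.≟ d)) v)) ([]=⇒lookup i)))
    λ ()

  -- The strategy-free form of a trap for Q; it agrees with IsTrap when S is a
  -- subgame.
  record Trap (Q : Player) (S T : Subset size) : Set where
    field
      ⊆S     : T ⊆ S
      closed : ∀ {v w} → v ∈ T → owner v ≡ Q → w ∈ S → w ∈ succs v → w ∈ T
      alive  : IsSubgame G T
  open Trap

  strategy-total : ∀ {P S σ v} → IsSubgame G S → Strategy G P S σ → v ∈ S → Nonempty (σ v)
  strategy-total {P} {v = v} sub strat v∈S with owner v ℙ.≟ P
  ... | yes q = Strategy.own strat v∈S q
  ... | no ¬q with w , w∈S , e ← sub v∈S =
    w , Strategy.other strat (≢⇒≡opponent ¬q) (v∈S , w∈S , e)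

  isTrap⇒trap : ∀ {Q S T} → IsSubgame G S → IsTrap G Q S T → Trap Q S T
  isTrap⇒trap {Q} sub (T⊆S , σ , strat , closedσ) = record
    { ⊆S = T⊆S
    ; closed = λ v∈T q w∈S e → closedσ v∈T
        (other (trans q (sym (ℙ.⁻¹-involutive Q))) (T⊆S v∈T , w∈S , e))
    ; alive = λ v∈T → let w , i = strategy-total sub strat (T⊆S v∈T) in
        w , closedσ v∈T i , proj₂ (proj₂ (edges i)) }
    where open Strategy strat

  trap⇒isTrap : ∀ {Q S T} → IsSubgame G S → Trap Q S T → IsTrap G Q S T
  trap⇒isTrap {Q} {S} {T} sub trap = ⊆S trap , σ ,
    record { edges = edges ; own = λ v∈S _ → own v∈S ; other = other } , closedσ
    where
    σ : EdgeSet G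
    -- Vertices of `T` keep exactly their moves inside `T`, all others keep every move of `S`;
    -- outside `S` there are no edges, as `Strategy` demands.
    σ v with v ∈? T | v ∈? S
    ... | yes _ | _     = T ∩ succs v
    ... | no _  | yes _ = S ∩ succs v
    ... | no _  | no _  = ∅
    edges : ∀ {v w} → w ∈ σ v → Edge G S v w
    edges {v} i with v ∈? T | v ∈? S
    ... | yes v∈T | _       with w∈T , e ← x∈p∩q⁻ T _ i = ⊆S trap v∈T , ⊆S trap w∈T , e
    ... | no _    | yes v∈S = v∈S , x∈p∩q⁻ S _ i
    ... | no _    | no _    = contradiction i ∉⊥
    own : ∀ {v} → v ∈ S → Nonempty (σ v)
    own {v} v∈S with v ∈? T | v ∈? S
    ... | yes v∈T | _       with w , e ← alive trap v∈T = w , x∈p∩q⁺ e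
    ... | no _    | yes _   with w , e ← sub v∈S = w , x∈p∩q⁺ e
    ... | no _    | no v∉S  = contradiction v∈S v∉S
    other : ∀ {v w} → owner v ≡ opponent (opponent Q) → Edge G S v w → w ∈ σ v
    other {v} q (v∈S , w∈S , e) with v ∈? T | v ∈? S
    ... | yes v∈T | _ =
      x∈p∩q⁺ (closed trap v∈T (trans q (ℙ.⁻¹-involutive Q)) w∈S e , e)
    ... | no _    | yes _   = x∈p∩q⁺ (w∈S , e)
    ... | no _    | no v∉S  = contradiction v∈S v∉S
    closedσ : ClosedUnder G σ T
    closedσ {v} v∈T i with v ∈? T | v ∈? S
    ... | yes _  | _ = proj₁ (x∈p∩q⁻ T _ i)
    ... | no v∉T | _ = contradiction v∈T v∉T

  trap-refl : ∀ {Q S} → IsSubgame G S → Trap Q S S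
  trap-refl sub = record { ⊆S = λ i → i ; closed = λ _ _ w∈S _ → w∈S ; alive = sub }

  trap-trans : ∀ {Q S T U} → Trap Q S T → Trap Q T U → Trap Q S U
  trap-trans t u = record
    { ⊆S = ⊆S t ∘ ⊆S u
    ; closed = λ v∈U q w∈S e → closed u v∈U q (closed t (⊆S u v∈U) q w∈S e) e
    ; alive = alive u }

  trap-restrict : ∀ {Q S R T} → Trap Q S T → R ⊆ S → T ⊆ R → Trap Q R T
  trap-restrict t R⊆S T⊆R = record
    { ⊆S = T⊆R ; closed = λ v∈T q w∈R → closed t v∈T q (R⊆S w∈R) ; alive = alive t }

  -- One set supplies a move and the other keeps it: a vertex of `P` has a move inside `Y`, which
  -- cannot leave `X`; for a vertex of `Q` the sets swap roles. The equation in place of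
  -- `opponent P` lets the players be exchanged, as `opponent` is not definitionally involutive.
  trap-∩ : ∀ {P Q S X Y} → Q ≡ opponent P → Trap P S X → Trap Q S Y → Trap P Y (X ∩ Y)
  trap-∩ {P} {X = X} {Y} refl x y = record
    { ⊆S = p∩q⊆q X Y
    ; closed = λ i q w∈Y e → x∈p∩q⁺ (closed x (p∩q⊆p X Y i) q (⊆S y w∈Y) e , w∈Y)
    ; alive = alive′ }
    where
    alive′ : IsSubgame G (X ∩ Y)
    alive′ {v} i with v∈X , v∈Y ← x∈p∩q⁻ X Y i | owner v ℙ.≟ P
    ... | yes q with w , w∈Y , e ← alive y v∈Y =
      w , x∈p∩q⁺ (closed x v∈X q (⊆S y w∈Y) e , w∈Y) , e
    ... | no ¬q with w , w∈X , e ← alive x v∈X =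
      w , x∈p∩q⁺ (w∈X , closed y v∈Y (≢⇒≡opponent ¬q) (⊆S x w∈X) e) , e

  trap-∩′ : ∀ {P Q S X Y} → Q ≡ opponent P → Trap P S X → Trap Q S Y → Trap Q X (X ∩ Y)
  trap-∩′ {P} {Q} {X = X} {Y} refl x y =
    subst (Trap Q X) (∩-comm Y X) (trap-∩ (sym (ℙ.⁻¹-involutive P)) y x)

  -- Attractors.

  Attracting : EdgeSet G → (A B : Subset size) → Set
  Attracting σ A B = (f : ℕ → Vertex G) → f 0 ∈ A → (∀ i → f (suc i) ∈ σ (f i)) → ∃ λ i → f i ∈ B

  -- `Attracting` speaks of bare vertex sequences. Generating them from states that carry an
  -- invariant keeps it available at the vertex where `B` is met.
  attracting-walk : ∀ {σ A B} {X : Set} (at : X → Vertex G) →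
                    (∀ x → ∃ λ y → at y ∈ σ (at x)) → Attracting σ A B →
                    ∀ x → at x ∈ A → ∃ λ y → at y ∈ B
  attracting-walk {X = X} at next reaches x x∈A =
    let i , b = reaches (at ∘ walk) x∈A (λ i → proj₂ (next (walk i))) in walk i , b
    where
    walk : ℕ → X
    walk zero    = x
    walk (suc i) = proj₁ (next (walk i))

  module _ {P : Player} {S B A : Subset size} (sub : IsSubgame G S) (att : IsAttractor G P S B A) where
    private
      B⊆A : B ⊆ A
      B⊆A = proj₁ (proj₁ att)

      A⊆S : A ⊆ S
      A⊆S = proj₁ (proj₂ (proj₁ att))

      σ : EdgeSet G
      σ = proj₁ (proj₂ (proj₂ (proj₁ att)))

      strat : Strategy G P S σ
      strat = proj₁ (proj₂ (proj₂ (proj₂ (proj₁ att))))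

      reaches : Attracting σ A B
      reaches = proj₂ (proj₂ (proj₂ (proj₂ (proj₁ att))))

      open Strategy strat

    -- Inside the trap `P` has no move out and the opponent always has a move that stays, so some
    -- path of the attractor strategy remains in `X` forever and would have to meet `B` there.
    trap-avoids-attractor : ∀ {X} → Trap P S X → (∀ {v} → v ∈ X → v ∉ B) →
                            ∀ {v} → v ∈ X → v ∉ A
    trap-avoids-attractor {X} t avoids v∈X v∈A =
      let (_ , w∈X) , w∈B = attracting-walk {σ} proj₁ next reaches (_ , v∈X) v∈A in avoids w∈X w∈B
      where
      next : (x : ∃ (_∈ X)) → ∃ λ (y : ∃ (_∈ X)) → proj₁ y ∈ σ (proj₁ x)
      next (u , u∈X) with owner u ℙ.≟ P
      ... | yes q with w , i ← own (⊆S t u∈X) q with _ , w∈S , e ← edges i =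
        (w , closed t u∈X q w∈S e) , i
      ... | no ¬q with w , w∈X , e ← alive t u∈X =
        (w , w∈X) , other (≢⇒≡opponent ¬q) (⊆S t u∈X , ⊆S t w∈X , e)

    -- By maximality of `A`: adjoining `y` gives another set from which `τ` forces a visit to `B`.
    attractor-absorbs : ∀ {y τ} → y ∈ S → Strategy G P S τ → Attracting τ A B →
                        ((f : ℕ → Vertex G) → f 0 ≡ y → (∀ i → f (suc i) ∈ τ (f i)) → ∃ λ i → f i ∈ B) →
                        y ∈ A
    attractor-absorbs {y} {τ} y∈S stratτ fromA fromy =
      proj₂ att (p⊆p∪q ⁅ y ⁆ ∘ B⊆A , A′⊆S , τ , stratτ , from) (q⊆p∪q A ⁅ y ⁆ (x∈⁅x⁆ y))
      where
      A′⊆S : A ∪ ⁅ y ⁆ ⊆ S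
      A′⊆S i with x∈p∪q⁻ A ⁅ y ⁆ i
      ... | inj₁ j = A⊆S j
      ... | inj₂ j = subst (_∈ S) (sym (x∈⁅y⁆⇒x≡y y j)) y∈S
      from : Attracting τ (A ∪ ⁅ y ⁆) B
      from f i path with x∈p∪q⁻ A ⁅ y ⁆ i
      ... | inj₁ j = fromA f j path
      ... | inj₂ j = fromy f (x∈⁅y⁆⇒x≡y y j) path

    private
      -- A path from `y`, prefixed with `x`, is a path from `A`. It does not meet `B` at `x`, so it
      -- does later, and `y` is absorbed.
      stays : ∀ {x y} → x ∈ A → x ∉ B → y ∈ σ x → y ∈ A
      stays {x} x∈A x∉B y∈σx =
        attractor-absorbs (proj₁ (proj₂ (edges y∈σx))) strat reaches fromy
        where
        fromy : ∀ f → f 0 ≡ _ → (∀ i → f (suc i) ∈ σ (f i)) → ∃ λ i → f i ∈ B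
        fromy f refl path = drop (reaches g x∈A path′)
          where
          g : ℕ → Vertex G
          g zero    = x
          g (suc i) = f i
          path′ : ∀ i → g (suc i) ∈ σ (g i)
          path′ zero    = y∈σx
          path′ (suc i) = path i
          drop : (∃ λ i → g i ∈ B) → ∃ λ i → f i ∈ B
          drop (zero  , x∈B) = contradiction x∈B x∉B
          drop (suc i , b)   = i , b

      -- Only the moves made before B is reached matter: a τ-path is followed
      -- inside A until it meets B, and is then continued with σ.
      attracting-transfer : ∀ {τ} → (∀ {u w} → u ∈ A → w ∈ τ u → w ∈ σ u) → Attracting τ A B
      attracting-transfer agree f f0∈A path =
        conclude (attracting-walk {σ} at next reaches (following 0 f0∈A) f0∈A)
        where
        data State : Set where
          following : ∀ i → f i ∈ A → State
          arrived   : (∃ λ i → f i ∈ B) → ∀ u → u ∈ S → State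
        at : State → Vertex G
        at (following i _) = f i
        at (arrived _ u _) = u
        continue : (∃ λ i → f i ∈ B) → ∀ {u} → u ∈ S → ∃ λ s → at s ∈ σ u
        continue r u∈S with w , i ← strategy-total sub strat u∈S =
          arrived r w (proj₁ (proj₂ (edges i))) , i
        next : ∀ s → ∃ λ s′ → at s′ ∈ σ (at s)
        next (arrived r u u∈S) = continue r u∈S
        next (following i fi∈A) with f i ∈? B
        ... | yes b  = continue (i , b) (A⊆S fi∈A)
        ... | no fi∉B = following (suc i) (stays fi∈A fi∉B j) , j
          where j = agree fi∈A (path i)
        conclude : (∃ λ s → at s ∈ B) → ∃ λ i → f i ∈ B
        conclude (following i _ , b) = i , b
        conclude (arrived r _ _ , _) = r

    -- Were `v` outside `A`, redirecting it to `w` would leave the strategy unchanged on `A`, so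
    -- `attracting-transfer` applies there, and every path from `v` enters `A` after one step; thus
    -- `v` is absorbed.
    attractor-closed : ∀ {v w} → v ∈ S → owner v ≡ P → w ∈ A → w ∈ succs v → v ∈ A
    attractor-closed {v} {w} v∈S q w∈A e with v ∈? A
    ... | yes v∈A = v∈A
    ... | no v∉A = attractor-absorbs v∈S
        (record { edges = edges′ ; own = own′ ; other = other′ })
        fromA step
      where
      σ′ : EdgeSet G
      σ′ u with u ≟ v
      ... | yes _ = ⁅ w ⁆
      ... | no  _ = σ u
      edges′ : ∀ {u x} → x ∈ σ′ u → Edge G S u x
      edges′ {u} i with u ≟ v
      ... | no  _    = edges i
      ... | yes refl with refl ← x∈⁅y⁆⇒x≡y w i = v∈S , A⊆S w∈A , e
      own′ : ∀ {u} → u ∈ S → owner u ≡ P → Nonempty (σ′ u)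
      own′ {u} u∈S r with u ≟ v
      ... | yes _ = w , x∈⁅x⁆ w
      ... | no  _ = own u∈S r
      other′ : ∀ {u x} → owner u ≡ opponent P → Edge G S u x → x ∈ σ′ u
      other′ {u} r i with u ≟ v
      ... | yes refl = contradiction (trans (sym q) r) (ℙ.p≢p⁻¹ P)
      ... | no  _    = other r i
      agree : ∀ {u x} → u ∈ A → x ∈ σ′ u → x ∈ σ u
      agree {u} u∈A i with u ≟ v
      ... | yes refl = contradiction u∈A v∉A
      ... | no  _    = i
      into : ∀ {x} → x ∈ σ′ v → x ∈ A
      into i with v ≟ v
      ... | yes _ with refl ← x∈⁅y⁆⇒x≡y w i = w∈A
      ... | no ¬p = contradiction refl ¬p
      fromA : Attracting σ′ A B
      fromA = attracting-transfer agree
      step : ∀ f → f 0 ≡ v → (∀ i → f (suc i) ∈ σ′ (f i)) → ∃ λ i → f i ∈ B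
      step f refl path with i , b ← fromA (f ∘ suc) (into (path 0)) (path ∘ suc) = suc i , b

    attractor-complement : Trap P S (S ─ A)
    attractor-complement = record
      { ⊆S = p─q⊆p S A
      ; closed = λ i q w∈S e → x∈p∧x∉q⇒x∈p─q w∈S λ w∈A →
          ∈─⇒∉ i (attractor-closed (p─q⊆p S A i) q w∈A e)
      ; alive = alive′ }
      where
      alive′ : IsSubgame G (S ─ A)
      -- `attractor` comes with a proof that its complement is a subgame; by maximality the two
      -- attractors are the same set.
      alive′ with A₀ , att₀ , rest ← attractor G P sub (A⊆S ∘ B⊆A)
        rewrite ⊆-antisym (proj₂ att₀ (proj₁ att)) (proj₂ att (proj₁ att₀)) = rest

  -- X ─ A′ avoids A as well, since it is a trap in S disjoint from B.
  complement-trap : ∀ {P S B A X B′ A′} → IsSubgame G S → IsAttractor G P S B A → Trap P S X →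
                    IsAttractor G P X B′ A′ → (∀ {v} → v ∈ X → v ∈ B → v ∈ B′) →
                    Trap P (S ─ A) (X ─ A′)
  complement-trap {S = S} {A = A} {X} {A′ = A′} sub att x att′ B∩X⊆B′ =
    trap-restrict t (p─q⊆p S A) λ i → x∈p∧x∉q⇒x∈p─q (⊆S t i)
      (trap-avoids-attractor sub att t (λ j b →
        ∈─⇒∉ j (proj₁ (proj₁ att′) (B∩X⊆B′ (p─q⊆p X A′ j) b))) i)
    where t = trap-trans x (attractor-complement (alive x) att′)

  -- Restricting attractor decompositions to traps.

  mutual
    -- The attractor is taken anew inside `X`; `complement-trap` makes what it leaves a trap in
    -- `S ─ A`, to which the layers restrict.
    restrict : ∀ {P e S X} → IsSubgame G S → (H : Decomposition G P e S) → Trap P S X →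
               ∃ λ (H′ : Decomposition G P e X) → tree G H Embeds tree G H′
    restrict {P} {e} {X = X} sub (decomposition att ls) x
      with A′ , att′ , _ ← attractor G P {B = X ∩ ofPriority G e} (alive x) (p∩q⊆p X _)
      with ls′ , p ← restrict-layers (alive (attractor-complement sub att)) ls
             (complement-trap sub att x att′ λ v∈X b → x∈p∩q⁺ (v∈X , p∩q⊆q _ _ b))
      = decomposition att′ ls′ , embeds p

    -- A layer `T` is cut down to `X ∩ T`, a trap for the opponent in `X` and for `P` in `T`.
    restrict-layers : ∀ {P e S X} → IsSubgame G S → (ls : Layers G P e S) → Trap P S X →
                      ∃ λ (ls′ : Layers G P e X) → trees G ls ⊒ trees G ls′
    restrict-layers sub (done empty) x = done (λ (v , i) → empty (v , ⊆S x i)) , []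
    restrict-layers {P} {X = X} sub (layer {T = T} ne isTrap low H att ls) x
      with t ← isTrap⇒trap sub isTrap
      with nonempty? (X ∩ T)
    ... | yes ne′
      with A′ , att′ , _ ← attractor G P {B = X ∩ T} (alive x) (p∩q⊆p X T)
      with H′ , h ← restrict (alive t) H (trap-∩ refl x t)
         | ls′ , p ← restrict-layers (alive (attractor-complement sub att)) ls
             (complement-trap sub att x att′ λ v∈X b → x∈p∩q⁺ (v∈X , b))
      = layer ne′ (trap⇒isTrap (alive x) (trap-∩′ refl x t)) (low ∘ p∩q⊆q X T) H′ att′ ls′ , h ∷ p
    -- Layers must be non-empty, so this one is dropped: `X` misses `T`, hence also its attractor,
    -- and lies in the remaining set.
    ... | no em
      with ls′ , p ← restrict-layers (alive (attractor-complement sub att)) ls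
             (trap-restrict x (p─q⊆p _ _) λ i → x∈p∧x∉q⇒x∈p─q (⊆S x i)
               (trap-avoids-attractor sub att x (λ v∈X v∈T → em (_ , x∈p∩q⁺ (v∈X , v∈T))) i))
      = ls′ , _ ∷ʳ p

  -- With nothing of priority `e`, the attractor to it misses `S`. Instead of identifying `S ─ A`
  -- with `S`, the layers are restricted to `S` as a trap in `S ─ A`.
  topless-layers : ∀ {P e S} → IsSubgame G S → (∀ {v} → v ∈ S → π v ≢ e) →
                   (H : Decomposition G P e S) →
                   ∃ λ (ls : Layers G P e S) → tree G H Embeds node (trees G ls)
  topless-layers {S = S} sub ≢e (decomposition att ls)
    with ls′ , p ← restrict-layers (alive (attractor-complement sub att)) ls
           (trap-restrict (trap-refl sub) (p─q⊆p _ _) λ i → x∈p∧x∉q⇒x∈p─q i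
             (trap-avoids-attractor sub att (trap-refl sub)
               (λ j b → ≢e j (∈ofPriority⁻ (p∩q⊆q S _ b))) i))
    = ls′ , embeds p

  open Subgame

  -- One iteration of the loop.

  module Iteration (P : Player) (d : ℕ) (H : Subgame G) (U : Subset size) where

    H₁ H₂ : Subgame G
    H₁ = removeAttr G P H (ofPriority G (suc d))
    H₂ = removeAttr G (opponent P) H U

    private
      att₁ = proj₁ (proj₂ (attr G P H (ofPriority G (suc d))))
      att₂ = proj₁ (proj₂ (attr G (opponent P) H U))

    H₁-trap : Trap P (V H) (V H₁)
    H₁-trap = attractor-complement (isSubgame H) att₁

    H₂-trap : Trap (opponent P) (V H) (V H₂)
    H₂-trap = attractor-complement (isSubgame H) att₂

    H₁-priority : ∀ {v} → v ∈ V H₁ → π v ≢ suc d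
    H₁-priority i eq = ∈─⇒∉ i (proj₁ (proj₁ att₁) (x∈p∩q⁺ (⊆S H₁-trap i , ∈ofPriority⁺ eq)))

    H₁-low : (∀ {v} → v ∈ V H → π v ≤ suc d) → ∀ {v} → v ∈ V H₁ → π v ≤ d
    H₁-low low i = ℕ.≤-pred (ℕ.≤∧≢⇒< (low (⊆S H₁-trap i)) (H₁-priority i))

    H₂-avoids : ∀ {v} → v ∈ V H₂ → v ∉ U
    H₂-avoids i u = ∈─⇒∉ i (proj₁ (proj₁ att₂) (x∈p∩q⁺ (⊆S H₂-trap i , u)))

    trap⊆H₁ : ∀ {X} → Trap P (V H) X → (∀ {v} → v ∈ X → π v ≢ suc d) → X ⊆ V H₁
    trap⊆H₁ x ≢d i = x∈p∧x∉q⇒x∈p─q (⊆S x i)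
      (trap-avoids-attractor (isSubgame H) att₁ x
        (λ j b → ≢d j (∈ofPriority⁻ (p∩q⊆q (V H) _ b))) i)

    trap⊆H₂ : ∀ {X} → Trap (opponent P) (V H) X → (∀ {v} → v ∈ X → v ∉ U) → X ⊆ V H₂
    trap⊆H₂ x avoids i = x∈p∧x∉q⇒x∈p─q (⊆S x i)
      (trap-avoids-attractor (isSubgame H) att₂ x (λ j b → avoids j (p∩q⊆q (V H) U b)) i)

  -- The simultaneous induction on the priority bound and the subtrees.

  mutual
    univ-contains : ∀ {P Q} d H T ts {D} → Q ≡ opponent P →
      (∀ {v} → v ∈ V H → π v ≤ d) →
      height T ≤ ⌊ d /2⌋ → height (node ts) ≤ ⌈ d /2⌉ →
      Trap Q (V H) D → (dec : Decomposition G P d D) → T Embeds tree G dec →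
      D ⊆ V (univ G P H d T (node ts))
    univ-contains d       H T []       Q≡ low hT hts δ dec T⊒ = ⊆S δ
    -- A non-empty list of subtrees has positive height, so at bound 0 there is no iteration.
    univ-contains zero    H T (_ ∷ _)  Q≡ low hT ()
    univ-contains {P} (suc d) H T@(node rs) (t@(node us) ∷ ts) {D} refl low hT hts δ dec T⊒ =
      univ-contains (suc d) H₂ T ts refl (low ∘ ⊆S H₂-trap) hT (height-tail t ts hts)
        (trap-restrict δ (⊆S H₂-trap) D⊆H₂) dec T⊒
      where
      U = V (univ G (opponent P) (removeAttr G P H (ofPriority G (suc d))) d t T)
      open Iteration P d H U
      D⊆H₂ : D ⊆ V H₂
      D⊆H₂ = trap⊆H₂ δ avoids
        where
        U∩H₁∩D : Empty (U ∩ (V H₁ ∩ D))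
        U∩H₁∩D
          with dec′ , e ← restrict (alive δ) dec (trap-∩ refl H₁-trap δ)
          with ls , e′ ← topless-layers (alive (trap-∩ refl H₁-trap δ))
                 (H₁-priority ∘ p∩q⊆p (V H₁) D) dec′
          with embeds p ← embeds-trans (embeds-trans T⊒ e) e′ =
          -- By computation `⌊ suc d /2⌋` is `⌈ d /2⌉` and `⌈ suc d /2⌉` is `suc ⌊ d /2⌋`, so both
          -- height bounds pass to the swapped roles at `d`.
          univ-excludes d H₁ t rs (sym (ℙ.⁻¹-involutive P)) (H₁-low low)
            (height-head t ts hts) hT (trap-∩′ refl H₁-trap δ) ls p
        avoids : ∀ {v} → v ∈ D → v ∉ U
        avoids v∈D v∈U = U∩H₁∩D (_ , x∈p∩q⁺ (v∈U ,
          x∈p∩q⁺ (univ⊆ G (opponent P) H₁ d t T v∈U , v∈D)))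

    -- The level `suc d` exceeds every priority, so only the layers of a decomposition matter. Each
    -- layer is decomposed at level `d - 1`, the bound of the recursive call, where `univ-contains`
    -- applies.
    univ-excludes : ∀ {P Q} d H T ts {D} → Q ≡ opponent P →
      (∀ {v} → v ∈ V H → π v ≤ d) →
      height T ≤ ⌊ d /2⌋ → height (node ts) ≤ ⌈ d /2⌉ →
      Trap P (V H) D → (ls : Layers G Q (suc d) D) → ts ⊒ trees G ls →
      Empty (V (univ G P H d T (node ts)) ∩ D)
    univ-excludes d H T [] Q≡ low hT hts δ (done empty) [] (v , i) =
      empty (v , p∩q⊆q (V H) _ i)
    univ-excludes zero H T (_ ∷ _) Q≡ low hT ()
    univ-excludes {P} {Q} (suc d) H T@(node rs) (t@(node us) ∷ ts) {D} refl low hT hts δ ls p (v , i) =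
      univ-excludes (suc d) H₂ T ts refl (low ∘ ⊆S H₂-trap) hT (height-tail t ts hts)
        (trap-∩′ (sym (ℙ.⁻¹-involutive P)) H₂-trap δ) (proj₁ (next ls p)) (proj₂ (next ls p))
        (v , x∈p∩q⁺ (v∈R , x∈p∩q⁺ (univ⊆ G P H₂ (suc d) T (node ts) v∈R , v∈D)))
      where
      U = V (univ G Q (removeAttr G P H (ofPriority G (suc d))) d t T)
      open Iteration P d H U
      v∈R = proj₁ (x∈p∩q⁻ _ D i)
      v∈D = proj₂ (x∈p∩q⁻ _ D i)
      rest-trap : Trap Q D (V H₂ ∩ D)
      rest-trap = trap-∩ (sym (ℙ.⁻¹-involutive P)) H₂-trap δ
      skip : (ls : Layers G Q (suc (suc d)) D) → ts ⊒ trees G ls →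
             ∃ λ (ls′ : Layers G Q (suc (suc d)) (V H₂ ∩ D)) → ts ⊒ trees G ls′
      skip ls p = let ls′ , p′ = restrict-layers (alive δ) ls rest-trap in
        ls′ , ⊒-trans p p′
      next : (ls : Layers G Q (suc (suc d)) D) → (t ∷ ts) ⊒ trees G ls →
             ∃ λ (ls′ : Layers G Q (suc (suc d)) (V H₂ ∩ D)) → ts ⊒ trees G ls′
      next ls@(done _)            (_ ∷ʳ p) = skip ls p
      next ls@(layer _ _ _ _ _ _) (_ ∷ʳ p) = skip ls p
      -- Here `t` embeds the tree of the first layer. What `H₂` keeps of `D` misses that layer and
      -- its attractor, so the later layers restrict to it.
      next (layer {T = X} ne isTrap π≤d h att ls) (e ∷ p) =
        let ls′ , p′ = restrict-layers (alive (attractor-complement (alive δ) att)) ls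
              (trap-restrict rest-trap (p─q⊆p D _) λ i → x∈p∧x∉q⇒x∈p─q (p∩q⊆q (V H₂) D i)
                (trap-avoids-attractor (alive δ) att rest-trap
                  (λ j x → H₂-avoids (p∩q⊆p (V H₂) D j) (X⊆U x)) i))
        in ls′ , ⊒-trans p p′
        where
        ξ : Trap P (V H) X
        ξ = trap-trans δ (subst (λ R → Trap R D X) (ℙ.⁻¹-involutive P)
              (isTrap⇒trap (alive δ) isTrap))
        X⊆H₁ : X ⊆ V H₁
        X⊆H₁ = trap⊆H₁ ξ λ x → ℕ.<⇒≢ (s≤s (π≤d x))
        X⊆U : X ⊆ U
        X⊆U = univ-contains d H₁ t rs (sym (ℙ.⁻¹-involutive P)) (H₁-low low)
          (height-head t ts hts) hT (trap-restrict ξ (⊆S H₁-trap) X⊆H₁) h e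

  -- From complete runs to the successive games of the loop.

  -- Stopping after `i` iterations is a complete run on the first `i` subtrees, so the induction
  -- only has to treat final results.
  lookup-univGames : ∀ P H d T ts (i : Fin (suc (length ts))) →
    lookup (univGames G P H d T ts) i ≡ univ G P H d T (node (take (toℕ i) ts))
  lookup-univGames P H d T []       zero    = refl
  lookup-univGames P H d T (_ ∷ _)  zero    = refl
  lookup-univGames P H d T (_ ∷ ts) (suc i) = lookup-univGames P _ d T ts i

  dominion-trap : ∀ {Q D} → IsDominion G Q ⊤ D → Trap (opponent Q) ⊤ D
  dominion-trap {Q} (D⊆⊤ , σ , strat , closedσ , _) =
    isTrap⇒trap (isSubgame (whole G)) (D⊆⊤ , σ ,
      subst (λ R → Strategy G R ⊤ σ) (sym (ℙ.⁻¹-involutive Q)) strat , closedσ)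

  univGames-separates : ∀ P d T ts → (∀ v → π v ≤ d) → parity d ≡ P →
    height T ≤ ⌊ d /2⌋ → height (node ts) ≤ ⌈ d /2⌉ →
    ∀ (i : Fin (suc (length ts))) D D′ →
    IsDominion G P ⊤ D → EmbedsDominion G P d T D →
    IsDominion G (opponent P) ⊤ D′ →
    EmbedsDominion G (opponent P) d (node (take (toℕ i) ts)) D′ →
    Separates (V (lookup (univGames G P (whole G) d T ts) i)) D D′
  univGames-separates P d T ts low par hT hts i D D′ dom emb dom′ emb′
    rewrite lookup-univGames P (whole G) d T ts i
    with dec , e ← subst (λ l → ∃ λ (H : Decomposition G P l D) → T Embeds tree G H)
                         (level-≡ par) emb
       | dec′ , e′ ← subst (λ l → ∃ λ (H : Decomposition G (opponent P) l D′) →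
                                        node (take (toℕ i) ts) Embeds tree G H)
                           (level-opponent par) emb′
    -- The opponent's level is `suc d`, a priority that does not occur.
    with ls , e″ ← topless-layers (alive (dominion-trap dom′)) (λ _ → ℕ.<⇒≢ (s≤s (low _))) dec′
    with embeds p ← embeds-trans e′ e″ =
      univ-contains d (whole G) T ts′ refl (λ _ → low _) hT hts′ (dominion-trap dom) dec e
    , univ-excludes d (whole G) T ts′ refl (λ _ → low _) hT hts′
        (subst (λ Q → Trap Q ⊤ D′) (ℙ.⁻¹-involutive P) (dominion-trap dom′)) ls p
    where
    ts′ = take (toℕ i) ts
    hts′ = height-take (toℕ i) ts hts

⌊n/2⌋≡⌈n/2⌉ : ∀ n → parity n ≡ Even → ⌊ n /2⌋ ≡ ⌈ n /2⌉
⌊n/2⌋≡⌈n/2⌉ zero          _  = refl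
⌊n/2⌋≡⌈n/2⌉ (suc (suc n)) eq = cong suc (⌊n/2⌋≡⌈n/2⌉ n eq)

theorem17 : ∀ (G : ParityGame) (n d : ℕ) (tsEven tsOdd : List Tree) →
    Small G n d →
    height (node tsEven) ≤ ⌈ d /2⌉ →
    height (node tsOdd) ≤ ⌊ d /2⌋ →
    (parity d ≡ Even →
    ∀ (i : Fin (suc (length tsOdd))) (D D′ : Subset (ParityGame.size G)) →
    IsDominion G Even ⊤ D →
    EmbedsDominion G Even d (node tsEven) D →
    IsDominion G Odd ⊤ D′ →
    EmbedsDominion G Odd d (node (take (toℕ i) tsOdd)) D′ →
    Separates (Subgame.V (lookup (univGames G Even (whole G) d (node tsEven) tsOdd) i)) D D′)
    ×
    (parity d ≡ Odd →
    ∀ (i : Fin (suc (length tsEven))) (D D′ : Subset (ParityGame.size G)) →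
    IsDominion G Odd ⊤ D →
    EmbedsDominion G Odd d (node tsOdd) D →
    IsDominion G Even ⊤ D′ →
    EmbedsDominion G Even d (node (take (toℕ i) tsEven)) D′ →
    Separates (Subgame.V (lookup (univGames G Odd (whole G) d (node tsOdd) tsEven) i)) D D′)
theorem17 G n d tsEven tsOdd (_ , low) hEven hOdd =
    -- For even `d` both halves of `d` coincide, which reconciles the bounds; for odd `d` they
    -- already have the required form.
    (λ even → univGames-separates G Even d (node tsEven) tsOdd low even
       (subst (height (node tsEven) ≤_) (sym (⌊n/2⌋≡⌈n/2⌉ d even)) hEven)
       (subst (height (node tsOdd) ≤_) (⌊n/2⌋≡⌈n/2⌉ d even) hOdd))
  , (λ odd → univGames-separates G Odd d (node tsOdd) tsEven low odd hOdd hEven)
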